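{- Let $G$ be a simple, undirected, connected graph on $N$ vertices with edge set $E$ and degree sequence $d_1\le d_2\le\cdots\le d_N$. If $d_j=1$ for $1\le j\le M$, where $M<N$, then $$R^+(G)\ge N(N-4)+2|E|\left[M+\frac{(N-M)^2}{2|E|-M}\right].$$
   Context: For vertices $i,j$ of $G$, $R_{ij}$ denotes the effective resistance between $i$ and $j$ when every edge of $G$ is a unit resistor. The additive degree-Kirchhoff index is $R^+(G)=\sum_{i<j}(d_i+d_j)R_{ij}$, where $d_i$ is the degree of vertex $i$. -}

module Defs where

open import Level using (0ℓ)
open import Data.Nat.Base as ℕ using (ℕ)
import Data.Nat.Properties as ℕ
open import Data.Integer.Base using (+_)
open import Data.Rational.Base as ℚ using (ℚ; 0ℚ; _-_; _*_; _÷_; ≢-nonZero)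
import Data.Rational.Properties as ℚ
open import Data.Fin.Base using (Fin)
open import Data.Fin.Properties using (_≟_; _<?_)
open import Data.Bool.Base using (if_then_else_)
open import Data.Product.Base using (∃-syntax; _×_)
open import Relation.Binary.Core using (Rel)
open import Relation.Binary.Definitions using (Symmetric; Irreflexive; Decidable)
open import Relation.Binary.PropositionalEquality.Core using (_≡_)
open import Relation.Binary.Construct.Closure.ReflexiveTransitive using (Star)
open import Relation.Nullary.Decidable.Core using (Dec; yes; no; does; _×-dec_)
open import Algebra.Properties.CommutativeMonoid.Sum ℕ.+-0-commutativeMonoid using () renaming (sum to sumℕ) public
open import Algebra.Properties.CommutativeMonoid.Sum ℚ.+-0-commutativeMonoid using () renaming (sum to sumℚ) public

fromℕ : ℕ → ℚ
fromℕ n = + n ℚ./ 1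

𝟙 : ∀ {a} {A : Set a} → Dec A → ℕ
𝟙 a? = if does a? then 1 else 0

infixl 7 _÷₀_

-- Total division, with p ÷₀ 0 = 0.
_÷₀_ : ℚ → ℚ → ℚ
p ÷₀ q with q ℚ.≟ 0ℚ
... | yes _   = 0ℚ
... | no  q≢0 = _÷_ p q {{≢-nonZero q≢0}}

record SimpleGraph (n : ℕ) : Set₁ where
  infix 4 _~_ _~?_
  field
    _~_      : Rel (Fin n) 0ℓ
    _~?_     : Decidable _~_
    ~-sym    : Symmetric _~_
    ~-irrefl : Irreflexive _≡_ _~_

module _ {n : ℕ} (G : SimpleGraph n) where
  open SimpleGraph G

  Connected : Set
  Connected = ∀ i j → Star _~_ i j

  degree : Fin n → ℕ
  degree i = sumℕ λ j → 𝟙 (i ~? j)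

  -- Each undirected edge is counted once, as the pair i < j of its ends.
  edgeCount : ℕ
  edgeCount = sumℕ λ i → sumℕ λ j → 𝟙 ((i <? j) ×-dec (i ~? j))

  -- Net current flowing out of k into its neighbours when the vertices are
  -- held at the potentials v: by Ohm's law a unit resistor k ~ l carries
  -- the current v k - v l.
  outflow : (Fin n → ℚ) → Fin n → ℚ
  outflow v k = sumℚ λ l → fromℕ (𝟙 (k ~? l)) * (v k - v l)

  -- Kirchhoff's current law when a unit current enters at i and leaves at j.
  IsUnitCurrentPotential : Fin n → Fin n → (Fin n → ℚ) → Set
  IsUnitCurrentPotential i j v =
    ∀ k → outflow v k ≡ fromℕ (𝟙 (k ≟ i)) - fromℕ (𝟙 (k ≟ j))

  -- r is the potential difference that drives a unit current from i to j.
  -- In a connected graph there is exactly one such r, and it is rational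
  -- because the linear system for v has integer coefficients.
  IsEffectiveResistance : Fin n → Fin n → ℚ → Set
  IsEffectiveResistance i j r =
    ∃[ v ] IsUnitCurrentPotential i j v × r ≡ v i - v j

  additiveDegreeKirchhoff : (Fin n → Fin n → ℚ) → ℚ
  additiveDegreeKirchhoff R =
    sumℚ λ i → sumℚ λ j →
      fromℕ (𝟙 (i <? j)) * (fromℕ (degree i ℕ.+ degree j) * R i j)

{-# OPTIONS --safe #-}

-- Write uᵢ = 1/dᵢ and let Aᵢⱼ be the adjacency indicator. Testing the effective
-- resistance against the potential uᵢ δᵢ - uⱼ δⱼ gives
--   Rᵢⱼ ≥ uᵢ + uⱼ - 2 Aᵢⱼ uᵢ uⱼ   (i ≠ j).
-- Multiplying by dᵢ + dⱼ and summing over pairs, the adjacency terms contribute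
-- -2 Σ_{i~j} (uᵢ + uⱼ) = -2N, whence R⁺ ≥ N(N - 4) + 2|E| Σ uⱼ. Among the terms of
-- Σ uⱼ the first M equal 1, and Cauchy-Schwarz bounds the rest by
-- (N - M)² / (2|E| - M).

module Submission where

open import Defs
open import Data.Nat.Base as ℕ using (ℕ; zero; suc; s≤s; z≤n)
import Data.Nat.Properties as ℕ
import Data.Integer.Base as ℤ
import Data.Integer.Properties as ℤ
open import Data.Fin.Base as Fin using (Fin; toℕ; zero; suc)
open import Data.Fin.Properties using (_≟_; _<?_; <-cmp; <⇒≢)
open import Data.Bool.Base using (if_then_else_)
open import Data.Product.Base using (∃-syntax; _,_)
open import Data.Rational.Base as ℚ
  using (ℚ; 0ℚ; 1ℚ; _+_; _-_; _*_; -_; _≤_; _≥_; NonNegative; ≢-nonZero; nonNegative)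
import Data.Rational.Properties as ℚ
import Data.Rational.Unnormalised.Base as ℚᵘ
import Data.Rational.Unnormalised.Properties as ℚᵘ
open import Data.Sum.Base using (inj₁; inj₂)
open import Data.Rational.Solver using (module +-*-Solver)
open import Algebra.Bundles using (CommutativeRing)
open import Algebra.Properties.CommutativeMonoid.Sum ℕ.+-0-commutativeMonoid
  using () renaming (sum-remove to sumℕ-remove)
open import Algebra.Properties.Semiring.Sum
  (CommutativeRing.semiring ℚ.+-*-commutativeRing)
  using (∑-distrib-+; ∑-comm; *-distribˡ-sum; sum-cong-≗; sum-replicate-zero)
open import Function.Base using (_∘_)
open import Relation.Binary.Construct.Closure.ReflexiveTransitive using (ε; _◅_)
open import Relation.Binary.Definitions using (tri<; tri≈; tri>)
open import Relation.Binary.PropositionalEquality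
  using (_≡_; _≢_; refl; sym; trans; cong; cong₂; subst; subst₂; module ≡-Reasoning)
open import Relation.Nullary using (¬_; Dec; yes; no; contradiction)
open import Relation.Nullary.Decidable using (dec-true; dec-false; _×-dec_; from-yes)
open +-*-Solver using (solve; con; _:+_; _:*_; _:-_; _:=_; :-_)

-- Rational arithmetic and the embedding of the naturals.

2ℚ 4ℚ : ℚ
2ℚ = fromℕ 2
4ℚ = fromℕ 4

-- Addition in `ℚ` normalises by a gcd and does not compute on open terms, so the identity is
-- checked on unnormalised fractions with denominator 1 and carried back.
fromℕ-+ : ∀ a b → fromℕ (a ℕ.+ b) ≡ fromℕ a + fromℕ b
fromℕ-+ a b = ℚ.toℚᵘ-injective (begin-equality
  ℚ.toℚᵘ (fromℕ (a ℕ.+ b))             ≃⟨ ℚ.toℚᵘ-fromℚᵘ (ℚᵘ.mkℚᵘ (ℤ.+ (a ℕ.+ b)) 0) ⟩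
  ℚᵘ.mkℚᵘ (ℤ.+ (a ℕ.+ b)) 0            ≃⟨ ℚᵘ.*≡* (cong (ℤ._* ℤ.+ 1) (sym (cong₂ ℤ._+_ (ℤ.*-identityʳ (ℤ.+ a)) (ℤ.*-identityʳ (ℤ.+ b))))) ⟩
  ℚᵘ.mkℚᵘ (ℤ.+ a) 0 ℚᵘ.+ ℚᵘ.mkℚᵘ (ℤ.+ b) 0
    ≃⟨ ℚᵘ.+-cong (ℚ.toℚᵘ-fromℚᵘ (ℚᵘ.mkℚᵘ (ℤ.+ a) 0)) (ℚ.toℚᵘ-fromℚᵘ (ℚᵘ.mkℚᵘ (ℤ.+ b) 0)) ⟨
  ℚ.toℚᵘ (fromℕ a) ℚᵘ.+ ℚ.toℚᵘ (fromℕ b) ≃⟨ ℚ.toℚᵘ-homo-+ (fromℕ a) (fromℕ b) ⟨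
  ℚ.toℚᵘ (fromℕ a + fromℕ b)           ∎)
  where open ℚᵘ.≤-Reasoning

fromℕ-nonNeg : ∀ a → NonNegative (fromℕ a)
fromℕ-nonNeg a = ℚ.normalize-nonNeg a 1

fromℕ-sum : ∀ {n} (f : Fin n → ℕ) → fromℕ (sumℕ f) ≡ sumℚ (fromℕ ∘ f)
fromℕ-sum {zero}  f = refl
fromℕ-sum {suc n} f = trans (fromℕ-+ (f zero) _) (cong (fromℕ (f zero) +_) (fromℕ-sum (f ∘ suc)))

1≤⇒fromℕ≢0 : ∀ {a} → 1 ℕ.≤ a → fromℕ a ≢ 0ℚ
1≤⇒fromℕ≢0 {suc a} _ eq = ℚ.<-irrefl (sym eq) (ℚ.positive⁻¹ (fromℕ (suc a)) {{ℚ.normalize-pos (suc a) 1}})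

÷-inverse : ∀ p q .{{_ : ℚ.NonZero q}} → q * (p ℚ.÷ q) ≡ p
÷-inverse p q = begin
  q * (p * ℚ.1/ q)  ≡⟨ solve 3 (λ q p r → q :* (p :* r) := p :* (q :* r)) refl q p (ℚ.1/ q) ⟩
  p * (q * ℚ.1/ q)  ≡⟨ cong (p *_) (ℚ.*-inverseʳ q) ⟩
  p * 1ℚ            ≡⟨ ℚ.*-identityʳ p ⟩
  p                 ∎
  where open ≡-Reasoning

÷₀-inverse : ∀ p {q} → q ≢ 0ℚ → q * (p ÷₀ q) ≡ p
÷₀-inverse p {q} q≢0 with q ℚ.≟ 0ℚ
... | yes q≡0 = contradiction q≡0 q≢0
... | no  q≢0 = ÷-inverse p q {{≢-nonZero q≢0}}

*-÷₀-assoc : ∀ p q r → (p * q) ÷₀ r ≡ p * (q ÷₀ r)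
*-÷₀-assoc p q r with r ℚ.≟ 0ℚ
... | yes _   = sym (ℚ.*-zeroʳ p)
... | no  r≢0 = ℚ.*-assoc p q (ℚ.1/_ r {{≢-nonZero r≢0}})

-- The left side is the quadratic `2tp - t²q` at its critical point `t = p/q`, where `t * q = p`. If
-- `q` is 0, the default makes `t` zero and both sides vanish.
÷₀-optimal : ∀ p q → let t = p ÷₀ q in 2ℚ * t * p - t * t * q ≡ p * t
÷₀-optimal p q with q ℚ.≟ 0ℚ
... | yes _  = solve 2 (λ p q → con 2ℚ :* con 0ℚ :* p :- con 0ℚ :* con 0ℚ :* q := p :* con 0ℚ) refl p q
... | no q≢0 = begin
  2ℚ * t * p - t * t * q    ≡⟨ solve 3 (λ t p q → con 2ℚ :* t :* p :- t :* t :* q :=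
                                 con 2ℚ :* t :* p :- t :* (q :* t)) refl t p q ⟩
  2ℚ * t * p - t * (q * t)  ≡⟨ cong (λ z → 2ℚ * t * p - t * z) (÷-inverse p q {{≢-nonZero q≢0}}) ⟩
  2ℚ * t * p - t * p        ≡⟨ solve 2 (λ t p → con 2ℚ :* t :* p :- t :* p := p :* t) refl t p ⟩
  p * t                     ∎
  where
  open ≡-Reasoning
  t = ℚ._÷_ p q {{≢-nonZero q≢0}}

0≤p*p : ∀ p → 0ℚ ≤ p * p
0≤p*p p with ℚ.≤-total 0ℚ p
... | inj₁ 0≤p = ℚ.nonNegative⁻¹ _ {{ℚ.nonNeg*nonNeg⇒nonNeg p {{nonNegative 0≤p}} p {{nonNegative 0≤p}}}}
... | inj₂ p≤0 = ℚ.nonNegative⁻¹ _ {{ℚ.nonPos*nonPos⇒nonPos p {{ℚ.nonPositive p≤0}} p {{ℚ.nonPositive p≤0}}}}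

0≤* : ∀ {p q} → 0ℚ ≤ p → 0ℚ ≤ q → 0ℚ ≤ p * q
0≤* {p} {q} 0≤p 0≤q = ℚ.nonNegative⁻¹ _ {{ℚ.nonNeg*nonNeg⇒nonNeg p {{nonNegative 0≤p}} q {{nonNegative 0≤q}}}}

0≤-⇒≤ : ∀ {p q} → 0ℚ ≤ q - p → p ≤ q
0≤-⇒≤ {p} {q} h = subst₂ _≤_ (ℚ.+-identityˡ p)
  (solve 2 (λ p q → q :- p :+ p := q) refl p q) (ℚ.+-monoˡ-≤ p h)

-- Finite sums of rationals.

sum-mono-≤ : ∀ {n} {f g : Fin n → ℚ} → (∀ i → f i ≤ g i) → sumℚ f ≤ sumℚ g
sum-mono-≤ {zero}  h = ℚ.≤-refl
sum-mono-≤ {suc n} h = ℚ.+-mono-≤ (h zero) (sum-mono-≤ (h ∘ suc))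

sum-nonNeg : ∀ {n} {f : Fin n → ℚ} → (∀ i → 0ℚ ≤ f i) → 0ℚ ≤ sumℚ f
sum-nonNeg {n} {f} h = subst (_≤ sumℚ f) (sum-replicate-zero n) (sum-mono-≤ h)

sum-const : ∀ n c → sumℚ {n} (λ _ → c) ≡ fromℕ n * c
sum-const zero    c = sym (ℚ.*-zeroˡ c)
sum-const (suc n) c = begin
  c + sumℚ {n} (λ _ → c)  ≡⟨ cong (c +_) (sum-const n c) ⟩
  c + fromℕ n * c         ≡⟨ solve 2 (λ c k → c :+ k :* c := (con 1ℚ :+ k) :* c) refl c (fromℕ n) ⟩
  (1ℚ + fromℕ n) * c      ≡⟨ cong (_* c) (fromℕ-+ 1 n) ⟨
  fromℕ (suc n) * c       ∎
  where open ≡-Reasoning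

sum-*ˡ : ∀ {n} c (f : Fin n → ℚ) → sumℚ (λ i → c * f i) ≡ c * sumℚ f
sum-*ˡ c f = sym (*-distribˡ-sum c f)

sum-sub : ∀ {n} (f g : Fin n → ℚ) → sumℚ (λ i → f i - g i) ≡ sumℚ f - sumℚ g
sum-sub f g = begin
  sumℚ (λ i → f i - g i)                  ≡⟨ ∑-distrib-+ f (-_ ∘ g) ⟩
  sumℚ f + sumℚ (-_ ∘ g)                  ≡⟨ cong (sumℚ f +_) (sum-cong-≗ λ i → neg≡-1* (g i)) ⟩
  sumℚ f + sumℚ (λ i → - 1ℚ * g i)        ≡⟨ cong (sumℚ f +_) (sum-*ˡ (- 1ℚ) g) ⟩
  sumℚ f + - 1ℚ * sumℚ g                  ≡⟨ cong (sumℚ f +_) (neg≡-1* (sumℚ g)) ⟨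
  sumℚ f - sumℚ g                         ∎
  where
  open ≡-Reasoning
  neg≡-1* : ∀ p → - p ≡ - 1ℚ * p
  neg≡-1* = solve 1 (λ p → :- p := con (- 1ℚ) :* p) refl

δ : ∀ {n} → Fin n → Fin n → ℚ
δ i j = fromℕ (𝟙 (i ≟ j))

sum-δ : ∀ {n} (i : Fin n) (f : Fin n → ℚ) → sumℚ (λ j → δ j i * f j) ≡ f i
sum-δ {suc n} zero f = begin
  1ℚ * f zero + sumℚ (λ j → 0ℚ * f (suc j))  ≡⟨ cong₂ _+_ (ℚ.*-identityˡ (f zero)) (sum-*ˡ 0ℚ (f ∘ suc)) ⟩
  f zero + 0ℚ * sumℚ (f ∘ suc)               ≡⟨ cong (f zero +_) (ℚ.*-zeroˡ (sumℚ (f ∘ suc))) ⟩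
  f zero + 0ℚ                                ≡⟨ ℚ.+-identityʳ (f zero) ⟩
  f zero                                     ∎
  where open ≡-Reasoning
sum-δ {suc n} (suc i) f = begin
  0ℚ * f zero + sumℚ (λ j → δ j i * f (suc j))  ≡⟨ cong₂ _+_ (ℚ.*-zeroˡ (f zero)) (sum-δ i (f ∘ suc)) ⟩
  0ℚ + f (suc i)                                ≡⟨ ℚ.+-identityˡ (f (suc i)) ⟩
  f (suc i)                                     ∎
  where open ≡-Reasoning

-- Indicators and counting.

𝟙-true : ∀ {a} {A : Set a} (a? : Dec A) → A → 𝟙 a? ≡ 1
𝟙-true a? a = cong (if_then 1 else 0) (dec-true a? a)

𝟙-false : ∀ {a} {A : Set a} (a? : Dec A) → ¬ A → 𝟙 a? ≡ 0
𝟙-false a? ¬a = cong (if_then 1 else 0) (dec-false a? ¬a)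

𝟙-×-dec : ∀ {a b} {A : Set a} {B : Set b} (a? : Dec A) (b? : Dec B) →
          fromℕ (𝟙 (a? ×-dec b?)) ≡ fromℕ (𝟙 a?) * fromℕ (𝟙 b?)
𝟙-×-dec (yes _) b? = sym (ℚ.*-identityˡ (fromℕ (𝟙 b?)))
𝟙-×-dec (no _)  b? = sym (ℚ.*-zeroˡ (fromℕ (𝟙 b?)))

-- The comparison is asked for only where the indicator is 1, so a bound valid for `i < j` can be
-- summed over all pairs.
𝟙*-mono-≤ : ∀ {a} {A : Set a} (a? : Dec A) {p q} → (A → p ≤ q) →
            fromℕ (𝟙 a?) * p ≤ fromℕ (𝟙 a?) * q
𝟙*-mono-≤ (yes a) p≤q = ℚ.*-monoˡ-≤-nonNeg 1ℚ (p≤q a)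
𝟙*-mono-≤ (no _) {p} {q} _ = ℚ.≤-reflexive (trans (ℚ.*-zeroˡ p) (sym (ℚ.*-zeroˡ q)))

count-< : ∀ {m n} → m ℕ.≤ n → sumℕ {n} (λ j → 𝟙 (toℕ j ℕ.<? m)) ≡ m
count-< {zero}  {zero}  _         = refl
count-< {zero}  {suc n} _         = count-< {zero} {n} z≤n
count-< {suc m} {suc n} (s≤s m≤n) = cong suc (count-< m≤n)

-- Double sums over unordered pairs.

sum< : ∀ {n} → (Fin n → Fin n → ℚ) → ℚ
sum< g = sumℚ λ i → sumℚ λ j → fromℕ (𝟙 (i <? j)) * g i j

-- The square of index pairs splits into two triangles and the diagonal; exchanging the order of
-- summation and using symmetry identifies the triangles.
symmetric-sum : ∀ {n} (g : Fin n → Fin n → ℚ) → (∀ i j → g i j ≡ g j i) →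
                sumℚ (λ i → sumℚ (g i)) ≡ sum< g + sum< g + sumℚ (λ i → g i i)
symmetric-sum {n} g g-sym = begin
  sumℚ (λ i → sumℚ (g i))
    ≡⟨ (sum-cong-≗ λ i → trans (sum-cong-≗ (split i)) (trans
          (∑-distrib-+ (λ j → below i j + below j i) (λ j → δ j i * g i j))
          (cong₂ _+_ (∑-distrib-+ (below i) (λ j → below j i)) (sum-δ i (g i))))) ⟩
  sumℚ (λ i → sumℚ (below i) + sumℚ (λ j → below j i) + g i i)
    ≡⟨ ∑-distrib-+ (λ i → sumℚ (below i) + sumℚ (λ j → below j i)) (λ i → g i i) ⟩
  sumℚ (λ i → sumℚ (below i) + sumℚ (λ j → below j i)) + sumℚ (λ i → g i i)
    ≡⟨ cong (_+ sumℚ (λ i → g i i)) (trans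
          (∑-distrib-+ (λ i → sumℚ (below i)) (λ i → sumℚ (λ j → below j i)))
          (cong (sum< g +_) (sym (∑-comm below)))) ⟩
  sum< g + sum< g + sumℚ (λ i → g i i) ∎
  where
  open ≡-Reasoning
  below : Fin n → Fin n → ℚ
  below i j = fromℕ (𝟙 (i <? j)) * g i j

  -- By trichotomy exactly one of the three indicators equals 1.
  split : ∀ i j → g i j ≡ below i j + below j i + δ j i * g i j
  split i j with <-cmp i j
  ... | tri< i<j i≢j j≮i
    rewrite 𝟙-true (i <? j) i<j | 𝟙-false (j <? i) j≮i | 𝟙-false (j ≟ i) (i≢j ∘ sym)
    = solve 2 (λ p q → p := con 1ℚ :* p :+ con 0ℚ :* q :+ con 0ℚ :* p) refl (g i j) (g j i)
  ... | tri≈ i≮j i≡j j≮i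
    rewrite 𝟙-false (i <? j) i≮j | 𝟙-false (j <? i) j≮i | 𝟙-true (j ≟ i) (sym i≡j)
    = solve 2 (λ p q → p := con 0ℚ :* p :+ con 0ℚ :* q :+ con 1ℚ :* p) refl (g i j) (g j i)
  ... | tri> i≮j i≢j j<i
    rewrite 𝟙-false (i <? j) i≮j | 𝟙-true (j <? i) j<i | 𝟙-false (j ≟ i) (i≢j ∘ sym)
    = trans (g-sym i j) (solve 2 (λ p q → q := con 0ℚ :* p :+ con 1ℚ :* q :+ con 0ℚ :* p) refl (g i j) (g j i))

-- Adjacency, degrees and the handshake identity.

module _ {n : ℕ} (G : SimpleGraph n) where
  open SimpleGraph G

  adj : Fin n → Fin n → ℚ
  adj i j = fromℕ (𝟙 (i ~? j))

  deg : Fin n → ℚ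
  deg i = fromℕ (degree G i)

  adj-sym : ∀ i j → adj i j ≡ adj j i
  adj-sym i j with i ~? j
  ... | yes i~j = cong fromℕ (sym (𝟙-true (j ~? i) (~-sym i~j)))
  ... | no  i≁j = cong fromℕ (sym (𝟙-false (j ~? i) (i≁j ∘ ~-sym)))

  adj-irrefl : ∀ i → adj i i ≡ 0ℚ
  adj-irrefl i = cong fromℕ (𝟙-false (i ~? i) (~-irrefl refl))

  adj-nonNeg : ∀ i j → 0ℚ ≤ adj i j
  adj-nonNeg i j = ℚ.nonNegative⁻¹ _ {{fromℕ-nonNeg (𝟙 (i ~? j))}}

  sum-adj : ∀ i → sumℚ (adj i) ≡ deg i
  sum-adj i = sym (fromℕ-sum (λ j → 𝟙 (i ~? j)))

  -- The degrees are the row sums of the adjacency matrix, which is symmetric with zero diagonal;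
  -- its upper triangle counts the edges.
  handshake : sumℚ deg ≡ 2ℚ * fromℕ (edgeCount G)
  handshake = begin
    sumℚ deg                                   ≡⟨ sum-cong-≗ sum-adj ⟨
    sumℚ (λ i → sumℚ (adj i))                  ≡⟨ symmetric-sum adj adj-sym ⟩
    sum< adj + sum< adj + sumℚ (λ i → adj i i)
      ≡⟨ cong₂ (λ e z → e + e + z) sum<-adj (trans (sum-cong-≗ adj-irrefl) (sum-replicate-zero n)) ⟩
    E + E + 0ℚ                                 ≡⟨ solve 1 (λ e → e :+ e :+ con 0ℚ := con 2ℚ :* e) refl E ⟩
    2ℚ * E                                     ∎
    where
    open ≡-Reasoning
    E = fromℕ (edgeCount G)
    edge : Fin n → Fin n → ℕ
    edge i j = 𝟙 ((i <? j) ×-dec (i ~? j))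
    sum<-adj : sum< adj ≡ E
    sum<-adj = sym (trans (fromℕ-sum (λ i → sumℕ (edge i))) (sum-cong-≗ λ i →
      trans (fromℕ-sum (edge i)) (sum-cong-≗ λ j → 𝟙-×-dec (i <? j) (i ~? j))))

  -- The graph Laplacian and its quadratic form.

  outflow-deg : ∀ v k → outflow G v k ≡ deg k * v k - sumℚ (λ l → adj k l * v l)
  outflow-deg v k = begin
    sumℚ (λ l → adj k l * (v k - v l))
      ≡⟨ (sum-cong-≗ λ l → solve 3 (λ a x y → a :* (x :- y) := x :* a :- a :* y) refl (adj k l) (v k) (v l)) ⟩
    sumℚ (λ l → v k * adj k l - adj k l * v l)
      ≡⟨ sum-sub (λ l → v k * adj k l) (λ l → adj k l * v l) ⟩
    sumℚ (λ l → v k * adj k l) - s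
      ≡⟨ cong (_- s) (trans (sum-*ˡ (v k) (adj k)) (trans (cong (v k *_) (sum-adj k)) (ℚ.*-comm (v k) (deg k)))) ⟩
    deg k * v k - s ∎
    where
    open ≡-Reasoning
    s = sumℚ (λ l → adj k l * v l)

  -- The Laplacian is positive semidefinite: adding the energy to itself with `k` and `l` exchanged
  -- gives the sum of `adj k l * (x k - x l)²`, whose terms are nonnegative.
  energy-nonNeg : ∀ x → 0ℚ ≤ sumℚ (λ k → x k * outflow G x k)
  energy-nonNeg x = ℚ.*-cancelˡ-≤-pos 2ℚ (subst₂ _≤_ (sym (ℚ.*-zeroʳ 2ℚ)) twice
    (sum-nonNeg λ k → sum-nonNeg λ l → 0≤* (adj-nonNeg k l) (0≤p*p (x k - x l))))
    where
    open ≡-Reasoning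
    f : Fin n → Fin n → ℚ
    f k l = x k * (adj k l * (x k - x l))
    S = sumℚ (λ k → x k * outflow G x k)
    S≡ : sumℚ (λ k → sumℚ (f k)) ≡ S
    S≡ = sum-cong-≗ λ k → sum-*ˡ (x k) (λ l → adj k l * (x k - x l))
    pointwise : ∀ k l → adj k l * ((x k - x l) * (x k - x l)) ≡ f k l + f l k
    pointwise k l = trans
      (solve 3 (λ a p q → a :* ((p :- q) :* (p :- q)) := p :* (a :* (p :- q)) :+ q :* (a :* (q :- p)))
        refl (adj k l) (x k) (x l))
      (cong (λ a → f k l + x l * (a * (x l - x k))) (adj-sym k l))
    twice : sumℚ (λ k → sumℚ λ l → adj k l * ((x k - x l) * (x k - x l))) ≡ 2ℚ * S
    twice = begin
      sumℚ (λ k → sumℚ λ l → adj k l * ((x k - x l) * (x k - x l)))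
        ≡⟨ (sum-cong-≗ λ k → trans (sum-cong-≗ (pointwise k)) (∑-distrib-+ (f k) (λ l → f l k))) ⟩
      sumℚ (λ k → sumℚ (f k) + sumℚ (λ l → f l k))
        ≡⟨ ∑-distrib-+ (λ k → sumℚ (f k)) (λ k → sumℚ (λ l → f l k)) ⟩
      sumℚ (λ k → sumℚ (f k)) + sumℚ (λ k → sumℚ (λ l → f l k))
        ≡⟨ cong₂ _+_ S≡ (trans (sym (∑-comm f)) S≡) ⟩
      S + S ≡⟨ solve 1 (λ s → s :+ s := con 2ℚ :* s) refl S ⟩
      2ℚ * S ∎

  -- Stated as an equation so that the later computations are ring identities without division.
  Inverse-degrees : (Fin n → ℚ) → Set
  Inverse-degrees u = ∀ i → deg i * u i ≡ 1ℚ

  -- Lower bound for a single effective resistance.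

  module _ {u : Fin n → ℚ} (deg*u≡1 : Inverse-degrees u) where

    -- Thomson's principle with the test potential v = uᵢ δᵢ - uⱼ δⱼ: the
    -- difference x of v and the true potential w has nonnegative energy, and
    -- this energy is Rᵢⱼ minus the claimed bound.
    resistance-≥ : ∀ {i j r} → i ≢ j → IsEffectiveResistance G i j r →
                   u i + u j - 2ℚ * (adj i j * (u i * u j)) ≤ r
    resistance-≥ {i} {j} {r} i≢j (w , kcl , r≡) =
      0≤-⇒≤ (subst (0ℚ ≤_) energy (energy-nonNeg x))
      where
      open ≡-Reasoning
      a b A : ℚ
      a = u i
      b = u j
      A = adj i j

      x : Fin n → ℚ
      x k = w k - (a * δ k i - b * δ k j)

      deg-δ : ∀ k l → deg k * (u l * δ k l) ≡ δ k l
      deg-δ k l with k ≟ l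
      ... | yes refl = trans (cong (deg k *_) (ℚ.*-identityʳ (u k))) (deg*u≡1 k)
      ... | no  _    = trans (cong (deg k *_) (ℚ.*-zeroʳ (u l))) (ℚ.*-zeroʳ (deg k))

      sum-adj-x : ∀ k → sumℚ (λ l → adj k l * x l) ≡
                  sumℚ (λ l → adj k l * w l) - (a * adj k i - b * adj k j)
      sum-adj-x k = begin
        sumℚ (λ l → adj k l * x l)
          ≡⟨ (sum-cong-≗ λ l → solve 6 (λ e w a b p q →
                e :* (w :- (a :* p :- b :* q)) := e :* w :- (p :* (a :* e) :- q :* (b :* e)))
              refl (adj k l) (w l) a b (δ l i) (δ l j)) ⟩
        sumℚ (λ l → adj k l * w l - (δ l i * (a * adj k l) - δ l j * (b * adj k l)))
          ≡⟨ sum-sub (λ l → adj k l * w l) (λ l → δ l i * (a * adj k l) - δ l j * (b * adj k l)) ⟩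
        s - sumℚ (λ l → δ l i * (a * adj k l) - δ l j * (b * adj k l))
          ≡⟨ cong (λ z → s - z) (trans
               (sum-sub (λ l → δ l i * (a * adj k l)) (λ l → δ l j * (b * adj k l)))
               (cong₂ _-_ (sum-δ i (λ l → a * adj k l)) (sum-δ j (λ l → b * adj k l)))) ⟩
        s - (a * adj k i - b * adj k j) ∎
        where s = sumℚ (λ l → adj k l * w l)

      -- Since `deg k * u k` is 1, the degree part of the Laplacian of the test potential is exactly
      -- the unit source and sink of Kirchhoff's law. Subtracting cancels them and leaves only
      -- adjacency terms.
      outflow-x : ∀ k → outflow G x k ≡ a * adj k i - b * adj k j
      outflow-x k = begin
        outflow G x k
          ≡⟨ outflow-deg x k ⟩
        deg k * x k - sumℚ (λ l → adj k l * x l)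
          ≡⟨ cong (λ z → deg k * x k - z) (sum-adj-x k) ⟩
        deg k * (w k - (a * δ k i - b * δ k j)) - (s - c)
          ≡⟨ solve 6 (λ d w s c p q → d :* (w :- (p :- q)) :- (s :- c) :=
                (d :* w :- s) :- (d :* p :- d :* q) :+ c)
              refl (deg k) (w k) s c (a * δ k i) (b * δ k j) ⟩
        (deg k * w k - s) - (deg k * (a * δ k i) - deg k * (b * δ k j)) + c
          ≡⟨ cong₂ (λ y z → y - z + c) (trans (sym (outflow-deg w k)) (kcl k))
               (cong₂ _-_ (deg-δ k i) (deg-δ k j)) ⟩
        (δ k i - δ k j) - (δ k i - δ k j) + c
          ≡⟨ solve 2 (λ y c → y :- y :+ c := c) refl (δ k i - δ k j) c ⟩
        c ∎
        where
        s = sumℚ (λ l → adj k l * w l)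
        c = a * adj k i - b * adj k j

      -- Solving `outflow-x` for the neighbour sum eliminates the unknown neighbour sums of `w`; the
      -- energy needs it at `i` and at `j`.
      sum-adj-x′ : ∀ k → sumℚ (λ l → adj k l * x l) ≡ deg k * x k - (a * adj k i - b * adj k j)
      sum-adj-x′ k = begin
        s                                ≡⟨ solve 2 (λ y s → s := y :- (y :- s)) refl (deg k * x k) s ⟩
        deg k * x k - (deg k * x k - s)  ≡⟨ cong (λ z → deg k * x k - z) (trans (sym (outflow-deg x k)) (outflow-x k)) ⟩
        deg k * x k - (a * adj k i - b * adj k j) ∎
        where s = sumℚ (λ l → adj k l * x l)

      x-i : x i ≡ w i - a
      x-i = trans (cong₂ (λ p q → w i - (a * p - b * q))
                    (cong fromℕ (𝟙-true (i ≟ i) refl)) (cong fromℕ (𝟙-false (i ≟ j) i≢j)))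
        (solve 3 (λ w a b → w :- (a :* con 1ℚ :- b :* con 0ℚ) := w :- a) refl (w i) a b)

      x-j : x j ≡ w j + b
      x-j = trans (cong₂ (λ p q → w j - (a * p - b * q))
                    (cong fromℕ (𝟙-false (j ≟ i) (i≢j ∘ sym))) (cong fromℕ (𝟙-true (j ≟ j) refl)))
        (solve 3 (λ w a b → w :- (a :* con 0ℚ :- b :* con 1ℚ) := w :+ b) refl (w j) a b)

      energy : sumℚ (λ k → x k * outflow G x k) ≡ r - (a + b - 2ℚ * (A * (a * b)))
      energy = begin
        sumℚ (λ k → x k * outflow G x k)
          -- Symmetry of `adj` reduces the energy to the neighbour sums of `x` at the two vertices
          -- `i` and `j`.
          ≡⟨ (sum-cong-≗ λ k → trans
                (cong (x k *_) (trans (outflow-x k)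
                  (cong₂ (λ p q → a * p - b * q) (adj-sym k i) (adj-sym k j))))
                (solve 5 (λ x a b p q → x :* (a :* p :- b :* q) := a :* (p :* x) :- b :* (q :* x))
                  refl (x k) a b (adj i k) (adj j k))) ⟩
        sumℚ (λ k → a * (adj i k * x k) - b * (adj j k * x k))
          ≡⟨ trans (sum-sub (λ k → a * (adj i k * x k)) (λ k → b * (adj j k * x k)))
               (cong₂ _-_ (sum-*ˡ a (λ k → adj i k * x k)) (sum-*ˡ b (λ k → adj j k * x k))) ⟩
        a * sumℚ (λ k → adj i k * x k) - b * sumℚ (λ k → adj j k * x k)
          ≡⟨ cong₂ (λ p q → a * p - b * q) (sum-adj-x′ i) (sum-adj-x′ j) ⟩
        a * (deg i * x i - (a * adj i i - b * A)) - b * (deg j * x j - (a * adj j i - b * adj j j))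
          ≡⟨ cong₂ (λ p q → a * (deg i * x i - (a * p - b * A)) - b * (deg j * x j - (a * adj j i - b * q)))
               (adj-irrefl i) (adj-irrefl j) ⟩
        a * (deg i * x i - (a * 0ℚ - b * A)) - b * (deg j * x j - (a * adj j i - b * 0ℚ))
          ≡⟨ cong (λ q → a * (deg i * x i - (a * 0ℚ - b * A)) - b * (deg j * x j - (a * q - b * 0ℚ)))
               (adj-sym j i) ⟩
        a * (deg i * x i - (a * 0ℚ - b * A)) - b * (deg j * x j - (a * A - b * 0ℚ))
          -- The products degree times inverse degree are grouped so that they can be replaced by 1;
          -- the cross terms from `i` and `j` add up to the factor 2.
          ≡⟨ solve 7 (λ a b A d e x y →
                a :* (d :* x :- (a :* con 0ℚ :- b :* A)) :- b :* (e :* y :- (a :* A :- b :* con 0ℚ)) :=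
                (d :* a) :* x :- (e :* b) :* y :+ con 2ℚ :* (A :* (a :* b)))
              refl a b A (deg i) (deg j) (x i) (x j) ⟩
        (deg i * a) * x i - (deg j * b) * x j + 2ℚ * (A * (a * b))
          ≡⟨ cong (_+ 2ℚ * (A * (a * b))) (cong₂ _-_ (cong₂ _*_ (deg*u≡1 i) x-i) (cong₂ _*_ (deg*u≡1 j) x-j)) ⟩
        1ℚ * (w i - a) - 1ℚ * (w j + b) + 2ℚ * (A * (a * b))
          ≡⟨ solve 5 (λ v w a b z → con 1ℚ :* (v :- a) :- con 1ℚ :* (w :+ b) :+ z := (v :- w) :- (a :+ b :- z))
              refl (w i) (w j) a b (2ℚ * (A * (a * b))) ⟩
        (w i - w j) - (a + b - 2ℚ * (A * (a * b)))
          ≡⟨ cong (_- (a + b - 2ℚ * (A * (a * b)))) r≡ ⟨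
        r - (a + b - 2ℚ * (A * (a * b))) ∎

    -- Summing the resistance bound over all pairs.

    private
      N D U : ℚ
      N = fromℕ n
      D = sumℚ deg
      U = sumℚ u

      -- `g` is the weighted bound for one pair. `h` is a half of it whose row sums are immediate:
      -- `g i j` equals `h i j + h j i` once each `deg i * u i` is replaced by 1.
      g h : Fin n → Fin n → ℚ
      g i j = fromℕ (degree G i ℕ.+ degree G j) * (u i + u j - 2ℚ * (adj i j * (u i * u j)))
      h i j = 1ℚ + deg i * u j - 2ℚ * u i * adj i j

    open ≡-Reasoning

    private
      g≡h+h : ∀ i j → g i j ≡ h i j + h j i
      g≡h+h i j = begin
        g i j
          ≡⟨ cong (_* (a + b - 2ℚ * (A * (a * b)))) (fromℕ-+ (degree G i) (degree G j)) ⟩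
        (d + e) * (a + b - 2ℚ * (A * (a * b)))
          ≡⟨ solve 5 (λ d e a b A → (d :+ e) :* (a :+ b :- con 2ℚ :* (A :* (a :* b))) :=
               d :* a :+ d :* b :- con 2ℚ :* b :* A :* (d :* a)
               :+ (e :* b :+ e :* a :- con 2ℚ :* a :* A :* (e :* b))) refl d e a b A ⟩
        d * a + d * b - 2ℚ * b * A * (d * a) + (e * b + e * a - 2ℚ * a * A * (e * b))
          ≡⟨ cong₂ (λ p q → p + d * b - 2ℚ * b * A * p + (q + e * a - 2ℚ * a * A * q))
               (deg*u≡1 i) (deg*u≡1 j) ⟩
        1ℚ + d * b - 2ℚ * b * A * 1ℚ + (1ℚ + e * a - 2ℚ * a * A * 1ℚ)
          ≡⟨ solve 5 (λ d e a b A →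
               con 1ℚ :+ d :* b :- con 2ℚ :* b :* A :* con 1ℚ :+ (con 1ℚ :+ e :* a :- con 2ℚ :* a :* A :* con 1ℚ) :=
               con 1ℚ :+ d :* b :- con 2ℚ :* a :* A :+ (con 1ℚ :+ e :* a :- con 2ℚ :* b :* A)) refl d e a b A ⟩
        h i j + (1ℚ + e * a - 2ℚ * b * A)
          ≡⟨ cong (λ z → h i j + (1ℚ + e * a - 2ℚ * b * z)) (adj-sym i j) ⟩
        h i j + h j i ∎
        where
        a = u i
        b = u j
        d = deg i
        e = deg j
        A = adj i j

      g-sym : ∀ i j → g i j ≡ g j i
      g-sym i j = trans (g≡h+h i j) (trans (ℚ.+-comm (h i j) (h j i)) (sym (g≡h+h j i)))

      -- The full double sum also contains the pairs `i = j`, where the formula contributes 4; these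
      -- terms have to be removed later.
      g-diag : ∀ i → g i i ≡ 4ℚ
      g-diag i = begin
        g i i ≡⟨ g≡h+h i i ⟩
        h i i + h i i
          ≡⟨ cong₂ (λ p q → let t = 1ℚ + p - 2ℚ * u i * q in t + t) (deg*u≡1 i) (adj-irrefl i) ⟩
        1ℚ + 1ℚ - 2ℚ * u i * 0ℚ + (1ℚ + 1ℚ - 2ℚ * u i * 0ℚ)
          ≡⟨ solve 1 (λ u → let t = con 1ℚ :+ con 1ℚ :- con 2ℚ :* u :* con 0ℚ in t :+ t := con 4ℚ) refl (u i) ⟩
        4ℚ ∎

      sum-h : sumℚ (λ i → sumℚ (h i)) ≡ N * N + D * U - N * 2ℚ
      sum-h = begin
        sumℚ (λ i → sumℚ (h i))
          ≡⟨ sum-cong-≗ row ⟩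
        sumℚ (λ i → N + U * deg i - 2ℚ)
          ≡⟨ trans (sum-sub (λ i → N + U * deg i) (λ _ → 2ℚ))
               (cong₂ _-_ (trans (∑-distrib-+ (λ _ → N) (λ i → U * deg i))
                             (cong₂ _+_ (sum-const n N) (trans (sum-*ˡ U deg) (ℚ.*-comm U D))))
                          (sum-const n 2ℚ)) ⟩
        N * N + D * U - N * 2ℚ ∎
        where
        -- The adjacency term sums along the row to `2 * u i * deg i`, which is 2.
        row : ∀ i → sumℚ (h i) ≡ N + U * deg i - 2ℚ
        row i = begin
          sumℚ (h i)
            ≡⟨ trans (sum-sub (λ j → 1ℚ + deg i * u j) (λ j → 2ℚ * u i * adj i j))
                 (cong₂ _-_ (trans (∑-distrib-+ (λ _ → 1ℚ) (λ j → deg i * u j))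
                               (cong₂ _+_ (sum-const n 1ℚ) (sum-*ˡ (deg i) u)))
                            (trans (sum-*ˡ (2ℚ * u i) (adj i)) (cong (2ℚ * u i *_) (sum-adj i)))) ⟩
          N * 1ℚ + deg i * U - 2ℚ * u i * deg i
            ≡⟨ solve 4 (λ N d U u → N :* con 1ℚ :+ d :* U :- con 2ℚ :* u :* d :=
                 N :+ U :* d :- con 2ℚ :* (d :* u)) refl N (deg i) U (u i) ⟩
          N + U * deg i - 2ℚ * (deg i * u i)
            ≡⟨ cong (λ z → N + U * deg i - 2ℚ * z) (deg*u≡1 i) ⟩
          N + U * deg i - 2ℚ ∎

      -- Half of the full double sum of `g` without its diagonal `4N`. The sum of `h` loses `2N` to
      -- adjacency, and half the diagonal removes another `2N`, whence `N * (N - 4)`.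
      sum<-g : sum< g ≡ N * (N - 4ℚ) + D * U
      sum<-g = begin
        S
          ≡⟨ solve 2 (λ S N → S := con ℚ.½ :* (S :+ S :+ N :* con 4ℚ :- N :* con 4ℚ)) refl S N ⟩
        ℚ.½ * (S + S + N * 4ℚ - N * 4ℚ)
          ≡⟨ cong (λ z → ℚ.½ * (S + S + z - N * 4ℚ)) (trans (sum-cong-≗ g-diag) (sum-const n 4ℚ)) ⟨
        ℚ.½ * (S + S + sumℚ (λ i → g i i) - N * 4ℚ)
          ≡⟨ cong (λ z → ℚ.½ * (z - N * 4ℚ)) (trans (sym (symmetric-sum g g-sym)) sum-g) ⟩
        ℚ.½ * (H + H - N * 4ℚ)
          ≡⟨ cong (λ z → ℚ.½ * (z + z - N * 4ℚ)) sum-h ⟩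
        ℚ.½ * ((N * N + D * U - N * 2ℚ) + (N * N + D * U - N * 2ℚ) - N * 4ℚ)
          ≡⟨ solve 2 (λ N c → con ℚ.½ :* ((N :* N :+ c :- N :* con 2ℚ) :+ (N :* N :+ c :- N :* con 2ℚ) :- N :* con 4ℚ)
               := N :* (N :- con 4ℚ) :+ c) refl N (D * U) ⟩
        N * (N - 4ℚ) + D * U ∎
        where
        S = sum< g
        H = sumℚ (λ i → sumℚ (h i))
        sum-g : sumℚ (λ i → sumℚ (g i)) ≡ H + H
        sum-g = begin
          sumℚ (λ i → sumℚ (g i))
            ≡⟨ (sum-cong-≗ λ i → trans (sum-cong-≗ (g≡h+h i)) (∑-distrib-+ (h i) (λ j → h j i))) ⟩
          sumℚ (λ i → sumℚ (h i) + sumℚ (λ j → h j i))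
            ≡⟨ ∑-distrib-+ (λ i → sumℚ (h i)) (λ i → sumℚ (λ j → h j i)) ⟩
          H + sumℚ (λ i → sumℚ (λ j → h j i))
            ≡⟨ cong (H +_) (∑-comm h) ⟨
          H + H ∎

    additiveDegreeKirchhoff-≥ : ∀ {R} → (∀ i j → IsEffectiveResistance G i j (R i j)) →
      fromℕ n * (fromℕ n - 4ℚ) + sumℚ deg * sumℚ u ≤ additiveDegreeKirchhoff G R
    additiveDegreeKirchhoff-≥ {R} isR = subst (_≤ additiveDegreeKirchhoff G R) sum<-g
      (sum-mono-≤ λ i → sum-mono-≤ λ j → term i j)
      where
      rhs : Fin n → Fin n → ℚ
      rhs i j = fromℕ (degree G i ℕ.+ degree G j) * R i j

      term : ∀ i j → fromℕ (𝟙 (i <? j)) * g i j ≤ fromℕ (𝟙 (i <? j)) * rhs i j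
      -- The weight `degree G i + degree G j` is nonnegative, and `i < j` gives the distinctness
      -- that `resistance-≥` requires.
      term i j = 𝟙*-mono-≤ (i <? j) λ i<j → ℚ.*-monoˡ-≤-nonNeg (fromℕ (degree G i ℕ.+ degree G j))
        {{fromℕ-nonNeg (degree G i ℕ.+ degree G j)}} (resistance-≥ (<⇒≢ i<j) (isR i j))

    -- Cauchy-Schwarz for the vertices beyond the first m, in the form of the
    -- tangent line bound 1/d ≥ 2t - t²d at the optimal t.
    sum-inverse-≥ : ∀ {m} → m ℕ.≤ n → (∀ j → toℕ j ℕ.< m → degree G j ≡ 1) →
      fromℕ m + ((N - fromℕ m) * (N - fromℕ m)) ÷₀ (D - fromℕ m) ≤ sumℚ u
    sum-inverse-≥ {m} m≤n leaf = subst (_≤ U) sum-e (sum-mono-≤ λ j → tangent j (toℕ j ℕ.<? m))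
      where
      M K Q t : ℚ
      M = fromℕ m
      K = N - M
      Q = D - M
      t = K ÷₀ Q

      -- `e` covers both kinds of vertices in one expression linear in `c` and `deg`: it is 1 on the
      -- first `m` vertices and the tangent line elsewhere.
      c e : Fin n → ℚ
      c j = fromℕ (𝟙 (toℕ j ℕ.<? m))
      e j = c j + (2ℚ * t * (1ℚ - c j) - t * t * (deg j - c j))

      -- The decision is an argument so that matching on it evaluates the indicator.
      tangent : ∀ j (j<m? : Dec (toℕ j ℕ.< m)) → let c = fromℕ (𝟙 j<m?) in
                c + (2ℚ * t * (1ℚ - c) - t * t * (deg j - c)) ≤ u j
      tangent j (yes j<m) = ℚ.≤-reflexive (begin
        1ℚ + (2ℚ * t * (1ℚ - 1ℚ) - t * t * (deg j - 1ℚ))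
          ≡⟨ cong (λ d → 1ℚ + (2ℚ * t * (1ℚ - 1ℚ) - t * t * (d - 1ℚ))) deg≡1 ⟩
        1ℚ + (2ℚ * t * (1ℚ - 1ℚ) - t * t * (1ℚ - 1ℚ))
          ≡⟨ solve 1 (λ t → con 1ℚ :+ (con 2ℚ :* t :* (con 1ℚ :- con 1ℚ) :- t :* t :* (con 1ℚ :- con 1ℚ)) := con 1ℚ) refl t ⟩
        1ℚ          ≡⟨ deg*u≡1 j ⟨
        deg j * u j ≡⟨ cong (_* u j) deg≡1 ⟩
        1ℚ * u j    ≡⟨ ℚ.*-identityˡ (u j) ⟩
        u j         ∎)
        where
        deg≡1 : deg j ≡ 1ℚ
        deg≡1 = cong fromℕ (leaf j j<m)
      -- As `deg j * u j` is 1, the gap between `u j` and its tangent line is the nonnegative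
      -- `deg j * (u j - t)²`.
      tangent j (no _) = 0≤-⇒≤ (subst (0ℚ ≤_) (begin
        deg j * ((u j - t) * (u j - t))
          ≡⟨ solve 3 (λ d u t → d :* ((u :- t) :* (u :- t)) :=
               d :* u :* (u :- con 2ℚ :* t) :+ t :* t :* d) refl (deg j) (u j) t ⟩
        deg j * u j * (u j - 2ℚ * t) + t * t * deg j
          ≡⟨ cong (λ z → z * (u j - 2ℚ * t) + t * t * deg j) (deg*u≡1 j) ⟩
        1ℚ * (u j - 2ℚ * t) + t * t * deg j
          ≡⟨ solve 3 (λ d u t → con 1ℚ :* (u :- con 2ℚ :* t) :+ t :* t :* d :=
               u :- (con 0ℚ :+ (con 2ℚ :* t :* (con 1ℚ :- con 0ℚ) :- t :* t :* (d :- con 0ℚ))))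
              refl (deg j) (u j) t ⟩
        u j - (0ℚ + (2ℚ * t * (1ℚ - 0ℚ) - t * t * (deg j - 0ℚ))) ∎)
        (0≤* (ℚ.nonNegative⁻¹ (deg j) {{fromℕ-nonNeg (degree G j)}}) (0≤p*p (u j - t))))

      sum-c : sumℚ c ≡ M
      sum-c = trans (sym (fromℕ-sum {n} (λ j → 𝟙 (toℕ j ℕ.<? m)))) (cong fromℕ (count-< {m} {n} m≤n))

      sum-e : sumℚ e ≡ M + (K * K) ÷₀ Q
      sum-e = begin
        sumℚ e
          ≡⟨ ∑-distrib-+ c (λ j → 2ℚ * t * (1ℚ - c j) - t * t * (deg j - c j)) ⟩
        sumℚ c + sumℚ (λ j → 2ℚ * t * (1ℚ - c j) - t * t * (deg j - c j))
          ≡⟨ cong (sumℚ c +_) (trans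
               (sum-sub (λ j → 2ℚ * t * (1ℚ - c j)) (λ j → t * t * (deg j - c j)))
               (cong₂ _-_
                 (trans (sum-*ˡ (2ℚ * t) (λ j → 1ℚ - c j)) (cong (2ℚ * t *_)
                   (trans (sum-sub (λ _ → 1ℚ) c) (cong (_- sumℚ c) (trans (sum-const n 1ℚ) (ℚ.*-identityʳ N))))))
                 (trans (sum-*ˡ (t * t) (λ j → deg j - c j)) (cong (t * t *_) (sum-sub deg c))))) ⟩
        sumℚ c + (2ℚ * t * (N - sumℚ c) - t * t * (D - sumℚ c))
          ≡⟨ cong (λ z → z + (2ℚ * t * (N - z) - t * t * (D - z))) sum-c ⟩
        -- The choice `t = K ÷₀ Q` turns the quadratic into the Cauchy-Schwarz quotient.
        M + (2ℚ * t * K - t * t * Q)  ≡⟨ cong (M +_) (÷₀-optimal K Q) ⟩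
        M + K * t                     ≡⟨ cong (M +_) (*-÷₀-assoc K K Q) ⟨
        M + (K * K) ÷₀ Q              ∎

-- Positivity of degrees and the final estimate.

degree-pos : ∀ {n} (G : SimpleGraph n) → Connected G → 1 ℕ.< n → ∀ i → 1 ℕ.≤ degree G i
degree-pos {suc zero} _ _ (s≤s ())
degree-pos {suc (suc _)} G conn _ i = escape (other i)
  where
  open SimpleGraph G
  other : ∀ i → ∃[ j ] i ≢ j
  other zero    = suc zero , λ ()
  other (suc _) = zero , λ ()

  neighbour : ∀ {j} → i ~ j → 1 ℕ.≤ degree G i
  neighbour {j} i~j = subst (1 ℕ.≤_) (sym (sumℕ-remove {i = j} (λ k → 𝟙 (i ~? k))))
    (ℕ.≤-trans (ℕ.≤-reflexive (sym (𝟙-true (i ~? j) i~j))) (ℕ.m≤m+n _ _))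

  -- A path from `i` to a different vertex is nonempty, and its first edge is incident to `i`.
  escape : ∃[ j ] i ≢ j → 1 ℕ.≤ degree G i
  escape (j , i≢j) with conn i j
  ... | ε       = contradiction refl i≢j
  ... | i~k ◅ _ = neighbour i~k

theorem2 :
    ∀ (n m : ℕ) (G : SimpleGraph n) (R : Fin n → Fin n → ℚ) →
    Connected G →
    (∀ i j → IsEffectiveResistance G i j (R i j)) →
    (∀ i j → i Fin.≤ j → degree G i ℕ.≤ degree G j) →
    m ℕ.< n →
    (∀ j → toℕ j ℕ.< m → degree G j ≡ 1) →
    let N = fromℕ n
        M = fromℕ m
        E = fromℕ (edgeCount G)
    in additiveDegreeKirchhoff G R
         ≥ N * (N - fromℕ 4)
           + fromℕ 2 * E * (M + ((N - M) * (N - M)) ÷₀ (fromℕ 2 * E - M))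
-- On a single vertex the degree is 0 and has no inverse. Here the bound evaluates to -3, while the
-- index is an empty sum over pairs and equals 0.
theorem2 1 0 G R _ _ _ _ _ = ℚ.≤-trans
  (from-yes (1ℚ * (1ℚ - 4ℚ) + 2ℚ * 0ℚ * (0ℚ + ((1ℚ - 0ℚ) * (1ℚ - 0ℚ)) ÷₀ (2ℚ * 0ℚ - 0ℚ)) ℚ.≤? 0ℚ))
  (ℚ.≤-reflexive (sym (solve 1 (λ x → con 0ℚ :* x :+ con 0ℚ :+ con 0ℚ := con 0ℚ) refl
    (fromℕ (degree G zero ℕ.+ degree G zero) * R zero zero))))
theorem2 1 (suc _) _ _ _ _ _ (s≤s ()) _
theorem2 n@(suc (suc _)) m G R conn isR _ m<n leaf = begin
  -- The factor `D`, twice the edge count, is nonnegative, so the bound on the sum of inverse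
  -- degrees may be multiplied by it.
  N * (N - 4ℚ) + D * X           ≤⟨ ℚ.+-monoʳ-≤ (N * (N - 4ℚ)) (ℚ.*-monoˡ-≤-nonNeg D {{D-nonNeg}} X≤U) ⟩
  N * (N - 4ℚ) + D * sumℚ u      ≡⟨ cong (λ d → N * (N - 4ℚ) + d * sumℚ u) (handshake G) ⟨
  N * (N - 4ℚ) + sumℚ (deg G) * sumℚ u ≤⟨ additiveDegreeKirchhoff-≥ G deg*u≡1 isR ⟩
  additiveDegreeKirchhoff G R    ∎
  where
  open ℚ.≤-Reasoning
  N M D X : ℚ
  N = fromℕ n
  M = fromℕ m
  D = 2ℚ * fromℕ (edgeCount G)
  X = M + ((N - M) * (N - M)) ÷₀ (D - M)

  D-nonNeg : NonNegative D
  D-nonNeg = ℚ.nonNeg*nonNeg⇒nonNeg 2ℚ (fromℕ (edgeCount G)) {{fromℕ-nonNeg (edgeCount G)}}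

  deg≢0 : ∀ i → deg G i ≢ 0ℚ
  deg≢0 i = 1≤⇒fromℕ≢0 (degree-pos G conn (s≤s (s≤s z≤n)) i)

  u : Fin n → ℚ
  -- Connectedness makes every degree positive, so this is genuine division.
  u i = 1ℚ ÷₀ deg G i

  deg*u≡1 : Inverse-degrees G u
  deg*u≡1 i = ÷₀-inverse 1ℚ (deg≢0 i)

  X≤U : X ≤ sumℚ u
  X≤U = subst (λ d → M + ((N - M) * (N - M)) ÷₀ (d - M) ≤ sumℚ u) (handshake G)
    (sum-inverse-≥ G deg*u≡1 (ℕ.<⇒≤ m<n) leaf)
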